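{- For all $m\ge1$, $\Delta A(m)\in\{0,1\}$ and $\Delta B(m)\in\{0,1\}$. Moreover, for every $r\ge0$, \[ A(u_r)=B(u_r)=a_r,\qquad A(v_r)=B(v_r)=2a_r, \] and \[ B(u_r+1)=a_r+1,\quad A(v_r-1)=2a_r-1,\quad B(v_r-1)=2a_r,\quad A(u_{r+1}-1)=a_{r+1},\quad B(u_{r+1}-1)=a_{r+1}-1. \]
   Context: Let $\widetilde Q(1)=\widetilde Q(2)=1$ and $\widetilde Q(n)=\widetilde Q(n-\widetilde Q(n-1))+\widetilde Q(n-\widetilde Q(n-2))+(-1)^n$ for $n\ge3$ (this is well defined, and all values are odd). Put $A(m):=(\widetilde Q(2m-1)+1)/2$, $B(m):=(\widetilde Q(2m)+1)/2$, $\Delta A(m):=A(m+1)-A(m)$ and $\Delta B(m):=B(m+1)-B(m)$. For $r\ge0$ let $a_r:=(2\cdot4^{r+1}+1)/3$, $u_r:=2a_r-r-2$ and $v_r:=4a_r-r-2$. -}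

module Defs where

open import Data.Nat as ℕ using (ℕ; zero; suc; _∸_)
import Data.Nat.DivMod as ℕD
open import Data.Integer as ℤ using (ℤ; +_; _+_; _-_; _*_; _≤?_)
open import Data.Integer.DivMod using (_/_)
open import Data.List using (List; []; _∷_; _++_; length; lookup)
open import Data.Fin using (Fin; fromℕ<)
open import Data.Nat.Properties using (_<?_)
open import Relation.Nullary using (yes; no)

sgn : ℕ → ℤ
sgn zero = + 1
sgn (suc n) = ℤ.- sgn n

-- Look up the value Q(k) in the list [Q(1), ..., Q(N)].
-- Out-of-range indices (k ≤ 0 or k > N) give 0; this never happens
-- for the actual recursion (the sequence is well defined).
getQ : List ℤ → ℤ → ℤ
getQ l (+ zero) = + 0
getQ l (+ suc k) with k <? length l
... | yes p = lookup l (fromℕ< p)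
... | no _ = + 0
getQ l ℤ.-[1+ _ ] = + 0

qlist : ℕ → List ℤ
qlist zero = []
qlist (suc zero) = + 1 ∷ []
qlist (suc (suc zero)) = + 1 ∷ + 1 ∷ []
qlist (suc (suc (suc k))) =
  let l = qlist (suc (suc k))
      n = suc (suc (suc k))
  in l ++ ((getQ l (+ n - getQ l (+ (n ∸ 1))) + getQ l (+ n - getQ l (+ (n ∸ 2))) + sgn n) ∷ [])

-- Q̃(n), for n ≥ 1 (Q̃(0) = 0 is a junk value)
Qt : ℕ → ℤ
Qt n = getQ (qlist n) (+ n)

-- A(m) = (Q̃(2m-1)+1)/2 , B(m) = (Q̃(2m)+1)/2   (intended for m ≥ 1)
A : ℕ → ℤ
A m = (Qt (2 ℕ.* m ∸ 1) + + 1) / (+ 2)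

B : ℕ → ℤ
B m = (Qt (2 ℕ.* m) + + 1) / (+ 2)

ΔA : ℕ → ℤ
ΔA m = A (suc m) - A m

ΔB : ℕ → ℤ
ΔB m = B (suc m) - B m

a : ℕ → ℕ
a r = (2 ℕ.* 4 ℕ.^ suc r ℕ.+ 1) ℕD./ 3

u : ℕ → ℕ
u r = 2 ℕ.* a r ∸ r ∸ 2

v : ℕ → ℕ
v r = 4 ℕ.* a r ∸ r ∸ 2

{-# OPTIONS --safe #-}

-- Put X i = A(i+1) − 1 and Y i = B(i+1) − 1.  The recursion for Q̃ becomes
--   X (i+1) = Y (i − Y i) + Y (i − X i),   Y (i+1) = 1 + X (i+1 − X (i+1)) + X (i+1 − Y i),
-- so that everything is read off at two pointers p = i − X i and q = i − Y i.
-- Between u_r and v_r the increments satisfy ΔA(m) + ΔB(m) = 1, and between v_r and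
-- u_{r+1} they satisfy ΔB(m) + ΔA(m+1) = 1.  In either phase exactly one pointer moves at
-- each step, the pointers range over the preceding phase, and the complementarity there
-- forces the complementarity here.  A pointer cannot leave that range because A and B have
-- increments 0 or 1; as p + q is determined by i, both pointers reach the end of the range
-- at the same time, which yields A = B at u_r and v_r.
module Submission where

open import Defs
open import Data.Nat
open import Data.Nat.Properties
open import Data.Nat.DivMod using (m*n/n≡m)
open import Data.Nat.Tactic.RingSolver using (solve-∀)
open import Data.Product using (_×_; _,_; proj₁; proj₂; ∃)
open import Data.Sum using (_⊎_; inj₁; inj₂; [_,_]′)
open import Function using (_∘_)
open import Relation.Nullary using (¬_; contradiction; yes; no)
open import Relation.Binary.PropositionalEquality using (_≡_; refl; sym; trans; cong; cong₂; subst)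

-- The two recurrences

-- Fuel 2i suffices for X i and 2i + 1 for Y i.
mutual
  fuelX : ℕ → ℕ → ℕ
  fuelX _       zero    = 0
  fuelX zero    (suc _) = 0
  fuelX (suc n) (suc i) = fuelY n (i ∸ fuelY n i) + fuelY n (i ∸ fuelX n i)

  fuelY : ℕ → ℕ → ℕ
  fuelY _       zero    = 0
  fuelY zero    (suc _) = 0
  fuelY (suc n) (suc i) = suc (fuelX n (suc i ∸ fuelX n (suc i)) + fuelX n (suc i ∸ fuelY n i))

mutual
  -- In the order X 0, Y 0, X 1, Y 1, ... the value `X i` has rank 2i and `Y i` rank 2i + 1. Every
  -- recursive call goes to a smaller rank, so the joint induction on fuel never runs dry.
  fuelX-stable : ∀ n m i → i + i ≤ n → i + i ≤ m → fuelX n i ≡ fuelX m i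
  fuelX-stable _ _ zero _ _ = refl
  fuelX-stable (suc n) (suc m) (suc i) (s≤s h) (s≤s h′) =
    cong₂ _+_ (at (stableY i ≤-refl)) (at (fuelX-stable n m i (below h) (below h′)))
    where
    below : ∀ {n} → i + suc i ≤ n → i + i ≤ n
    below = ≤-trans (+-monoʳ-≤ i (n≤1+n i))
    odd : ∀ {n} → i + suc i ≤ n → ∀ {j} → j ≤ i → suc (j + j) ≤ n
    odd h j≤i = ≤-trans (s≤s (+-mono-≤ j≤i j≤i)) (≤-trans (≤-reflexive (sym (+-suc i i))) h)
    stableY : ∀ j → j ≤ i → fuelY n j ≡ fuelY m j
    stableY j j≤i = fuelY-stable n m j (odd h j≤i) (odd h′ j≤i)
    at : ∀ {z w} → z ≡ w → fuelY n (i ∸ z) ≡ fuelY m (i ∸ w)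
    at {z} refl = stableY (i ∸ z) (m∸n≤m i z)

  fuelY-stable : ∀ n m i → suc (i + i) ≤ n → suc (i + i) ≤ m → fuelY n i ≡ fuelY m i
  fuelY-stable _ _ zero _ _ = refl
  fuelY-stable (suc n) (suc m) (suc i) (s≤s h) (s≤s h′) =
    cong suc (cong₂ _+_ (at (stableX (suc i) ≤-refl)) (at (fuelY-stable n m i (below h) (below h′))))
    where
    below : ∀ {n} → suc (i + suc i) ≤ n → suc (i + i) ≤ n
    below = ≤-trans (s≤s (+-monoʳ-≤ i (n≤1+n i)))
    stableX : ∀ j → j ≤ suc i → fuelX n j ≡ fuelX m j
    stableX j j≤i = fuelX-stable n m j (≤-trans (+-mono-≤ j≤i j≤i) h) (≤-trans (+-mono-≤ j≤i j≤i) h′)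
    at : ∀ {z w} → z ≡ w → fuelX n (suc i ∸ z) ≡ fuelX m (suc i ∸ w)
    at {z} refl = stableX (suc i ∸ z) (m∸n≤m (suc i) z)

abstract
  -- Kept abstract, so that later proofs use only the recurrences and the tabulated values.
  X Y : ℕ → ℕ
  X i = fuelX (i + i) i
  Y i = fuelY (suc (i + i)) i

-- Pointers

-- The additive form of p = i - f i also records f i ≤ i, which avoids truncated subtraction.
record Ptr (f : ℕ → ℕ) (p i : ℕ) : Set where
  constructor ptr
  field split : p + f i ≡ i

  ∸-split : i ∸ f i ≡ p
  ∸-split = trans (cong (_∸ f i) (sym split)) (m+n∸n≡m p (f i))

  ptr-≤ : p ≤ i
  ptr-≤ = ≤-trans (m≤m+n p (f i)) (≤-reflexive split)

open Ptr

abstract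
  X-rec : ∀ {p q i} → Ptr X p i → Ptr Y q i → X (suc i) ≡ Y q + Y p
  X-rec {p} {q} {i} hp hq =
    cong₂ _+_ (at eqY (∸-split hq) (ptr-≤ hq)) (at eqX (∸-split hp) (ptr-≤ hp))
    where
    le : ∀ {j} → j ≤ i → suc (j + j) ≤ i + suc i
    le j≤i = ≤-trans (s≤s (+-mono-≤ j≤i j≤i)) (≤-reflexive (sym (+-suc i i)))
    eqY : fuelY (i + suc i) i ≡ Y i
    eqY = fuelY-stable _ _ i (le ≤-refl) ≤-refl
    eqX : fuelX (i + suc i) i ≡ X i
    eqX = fuelX-stable _ _ i (+-monoʳ-≤ i (n≤1+n i)) ≤-refl
    at : ∀ {j w z} → w ≡ z → i ∸ z ≡ j → j ≤ i → fuelY (i + suc i) (i ∸ w) ≡ Y j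
    at {j} refl refl j≤i = fuelY-stable _ _ j (le j≤i) ≤-refl

  -- The pointer `q` is taken at `i`, while the recurrence subtracts `Y i` from i + 1; hence
  -- `suc q`.
  Y-rec : ∀ {p q i} → Ptr X p (suc i) → Ptr Y q i → Y (suc i) ≡ suc (X p + X (suc q))
  Y-rec {p} {q} {i} hp hq =
    cong suc (cong₂ _+_ (at {w = X (suc i)} refl (∸-split hp) (ptr-≤ hp))
                        (at eqY (trans (+-∸-assoc 1 (Y≤ hq)) (cong suc (∸-split hq))) (s≤s (ptr-≤ hq))))
    where
    eqY : fuelY (suc i + suc i) i ≡ Y i
    eqY = fuelY-stable _ _ i (s≤s (+-monoʳ-≤ i (n≤1+n i))) ≤-refl
    Y≤ : Ptr Y q i → Y i ≤ i
    Y≤ (ptr e) = ≤-trans (m≤n+m (Y i) q) (≤-reflexive e)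
    at : ∀ {j w z} → w ≡ z → suc i ∸ z ≡ j → j ≤ suc i → fuelX (suc i + suc i) (suc i ∸ w) ≡ X j
    at {j} refl refl j≤i = fuelX-stable _ _ j (+-mono-≤ j≤i j≤i) ≤-refl

  X-values : X 0 ≡ 0 × X 1 ≡ 0 × X 2 ≡ 1 × X 3 ≡ 2 × X 4 ≡ 2 × X 5 ≡ 2
  X-values = refl , refl , refl , refl , refl , refl

  Y-values : Y 0 ≡ 0 × Y 1 ≡ 1 × Y 2 ≡ 1 × Y 3 ≡ 2 × Y 4 ≡ 3
  Y-values = refl , refl , refl , refl , refl

advance : ∀ {f p i} → f (suc i) ≡ f i → Ptr f p i → Ptr f (suc p) (suc i)
advance {p = p} e (ptr h) = ptr (cong suc (trans (cong (p +_) e) h))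

hold : ∀ {f p i} → f (suc i) ≡ suc (f i) → Ptr f p i → Ptr f p (suc i)
hold {f} {p} {i} e (ptr h) = ptr (trans (cong (p +_) e) (trans (+-suc p (f i)) (cong suc h)))

advance⁻¹ : ∀ {f p i} → Ptr f p i → Ptr f (suc p) (suc i) → f (suc i) ≡ f i
advance⁻¹ {f} {p} {i} (ptr h) (ptr h′) = +-cancelˡ-≡ p _ _ (trans (suc-injective h′) (sym h))

hold⁻¹ : ∀ {f p i} → Ptr f p i → Ptr f p (suc i) → f (suc i) ≡ suc (f i)
hold⁻¹ {f} {p} {i} (ptr h) (ptr h′) =
  +-cancelˡ-≡ p _ _ (trans h′ (trans (cong suc (sym h)) (sym (+-suc p (f i)))))

-- Complementary increments and their transfer along the pointers

Unit : (ℕ → ℕ) → ℕ → Set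
Unit f i = f (suc i) ≡ f i ⊎ f (suc i) ≡ suc (f i)

-- Complementarity of increments in phase I (Dual) and in phase II (Dual⁺).
Dual : ℕ → Set
Dual j = (X (suc j) ≡ X j × Y (suc j) ≡ suc (Y j)) ⊎ (X (suc j) ≡ suc (X j) × Y (suc j) ≡ Y j)

Dual⁺ : ℕ → Set
Dual⁺ j = (Y (suc j) ≡ Y j × X (2 + j) ≡ suc (X (suc j)))
        ⊎ (Y (suc j) ≡ suc (Y j) × X (2 + j) ≡ X (suc j))

-- The extra equation in the second case is what keeps the two increments of Y (2 + i) from
-- adding up when p moves again.
Move : ℕ → ℕ → ℕ → Set
Move p q i = (Ptr X (suc p) (suc i) × Ptr Y q (suc i))
           ⊎ (Ptr X p (suc i) × Ptr Y (suc q) (suc i) × X (suc p) ≡ X p)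

-- As only `p` has moved, the increment of `X` at `suc i` is that of `Y` at the old `p`. If it is 0,
-- `p` moves again and `Y` gains the increment of `X` at `suc p`; if it is 1, `Y-rec` is read at the
-- same places as before.
moveX : ∀ {p q i} → Ptr X p i → Ptr Y q i → Dual⁺ p →
        Ptr X (suc p) (suc i) → Ptr Y q (suc i) → Move (suc p) q (suc i)
moveX {p} {q} {i} hp hq (inj₁ (ey , ex)) hp′ hq′ = inj₁ (hp″ , hold eY hq′)
  where
  eX : X (2 + i) ≡ X (suc i)
  eX = trans (X-rec hp′ hq′) (trans (cong (Y q +_) ey) (sym (X-rec hp hq)))
  hp″ : Ptr X (2 + p) (2 + i)
  hp″ = advance eX hp′
  eY : Y (2 + i) ≡ suc (Y (suc i))
  eY = trans (Y-rec hp″ hq′) (cong suc (trans (cong (_+ X (suc q)) ex) (sym (Y-rec hp′ hq))))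
moveX {p} {q} {i} hp hq (inj₂ (ey , ex)) hp′ hq′ = inj₂ (hp″ , advance eY hq′ , ex)
  where
  eX : X (2 + i) ≡ suc (X (suc i))
  eX = trans (X-rec hp′ hq′) (trans (cong (Y q +_) ey)
      (trans (+-suc (Y q) (Y p)) (cong suc (sym (X-rec hp hq)))))
  hp″ : Ptr X (suc p) (2 + i)
  hp″ = hold eX hp′
  eY : Y (2 + i) ≡ Y (suc i)
  eY = trans (Y-rec hp″ hq′) (sym (Y-rec hp′ hq))

-- Now the increment of `X` is that of `Y` at the old `q`. If it is 0, `p` moves too and both terms
-- of `Y-rec` shift; the last hypothesis cancels the contribution of `p`.
moveY : ∀ {p q i} → Ptr X p i → Ptr Y q i → Dual⁺ q →
        Ptr X p (suc i) → Ptr Y (suc q) (suc i) → X (suc p) ≡ X p → Move p (suc q) (suc i)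
moveY {p} {q} {i} hp hq (inj₁ (ey , ex)) hp′ hq′ e = inj₁ (hp″ , hold eY hq′)
  where
  eX : X (2 + i) ≡ X (suc i)
  eX = trans (X-rec hp′ hq′) (trans (cong (_+ Y p) ey) (sym (X-rec hp hq)))
  hp″ : Ptr X (suc p) (2 + i)
  hp″ = advance eX hp′
  eY : Y (2 + i) ≡ suc (Y (suc i))
  eY = trans (Y-rec hp″ hq′)
      (cong suc (trans (cong₂ _+_ e ex) (trans (+-suc (X p) _) (sym (Y-rec hp′ hq)))))
moveY {p} {q} {i} hp hq (inj₂ (ey , ex)) hp′ hq′ e = inj₂ (hp″ , advance eY hq′ , e)
  where
  eX : X (2 + i) ≡ suc (X (suc i))
  eX = trans (X-rec hp′ hq′) (trans (cong (_+ Y p) ey) (cong suc (sym (X-rec hp hq))))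
  hp″ : Ptr X p (2 + i)
  hp″ = hold eX hp′
  eY : Y (2 + i) ≡ Y (suc i)
  eY = trans (Y-rec hp″ hq′) (trans (cong (λ z → suc (X p + z)) ex) (sym (Y-rec hp′ hq)))

-- Here `X` is followed one index ahead of `Y`. The guard now sits on the move of `p`: if `q` moves
-- next, both terms of `X-rec` shift.
Move⁺ : ℕ → ℕ → ℕ → Set
Move⁺ p q i = (Ptr X (suc p) (2 + i) × Ptr Y q (suc i) × Y (suc q) ≡ Y q)
            ⊎ (Ptr X p (2 + i) × Ptr Y (suc q) (suc i))

-- The roles are exchanged: `Y` is determined first, with the increment of `X` at the old `p`. If
-- that is 0, `q` moves and the guard leaves only the increment of `Y` at `p` to act on `X`.
moveX⁺ : ∀ {p q i} → Ptr X p (suc i) → Ptr Y q i → Dual p →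
         Ptr X (suc p) (2 + i) → Ptr Y q (suc i) → Y (suc q) ≡ Y q → Move⁺ (suc p) q (suc i)
moveX⁺ {p} {q} {i} hp hq (inj₁ (ex , ey)) hp′ hq′ e = inj₂ (hold eX hp′ , hq″)
  where
  eY : Y (2 + i) ≡ Y (suc i)
  eY = trans (Y-rec hp′ hq′) (trans (cong (λ z → suc (z + X (suc q))) ex) (sym (Y-rec hp hq)))
  hq″ : Ptr Y (suc q) (2 + i)
  hq″ = advance eY hq′
  eX : X (3 + i) ≡ suc (X (2 + i))
  eX = trans (X-rec hp′ hq″) (trans (cong₂ _+_ e ey)
      (trans (+-suc (Y q) (Y p)) (cong suc (sym (X-rec hp hq′)))))
moveX⁺ {p} {q} {i} hp hq (inj₂ (ex , ey)) hp′ hq′ e = inj₁ (advance eX hp′ , hq″ , e)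
  where
  eY : Y (2 + i) ≡ suc (Y (suc i))
  eY = trans (Y-rec hp′ hq′) (cong suc (trans (cong (_+ X (suc q)) ex) (sym (Y-rec hp hq))))
  hq″ : Ptr Y q (2 + i)
  hq″ = hold eY hq′
  eX : X (3 + i) ≡ X (2 + i)
  eX = trans (X-rec hp′ hq″) (trans (cong (Y q +_) ey) (sym (X-rec hp hq′)))

-- Complementarity is used at `suc q` because `Y-rec` reads `X` one place past the pointer. Its
-- second case also supplies the guard for the next move of `p`.
moveY⁺ : ∀ {p q i} → Ptr X p (suc i) → Ptr Y q i → Dual (suc q) →
         Ptr X p (2 + i) → Ptr Y (suc q) (suc i) → Move⁺ p (suc q) (suc i)
moveY⁺ {p} {q} {i} hp hq (inj₁ (ex , ey)) hp′ hq′ = inj₂ (hold eX hp′ , hq″)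
  where
  eY : Y (2 + i) ≡ Y (suc i)
  eY = trans (Y-rec hp′ hq′) (trans (cong (λ z → suc (X p + z)) ex) (sym (Y-rec hp hq)))
  hq″ : Ptr Y (2 + q) (2 + i)
  hq″ = advance eY hq′
  eX : X (3 + i) ≡ suc (X (2 + i))
  eX = trans (X-rec hp′ hq″) (trans (cong (_+ Y p) ey) (cong suc (sym (X-rec hp hq′))))
moveY⁺ {p} {q} {i} hp hq (inj₂ (ex , ey)) hp′ hq′ = inj₁ (advance eX hp′ , hq″ , ey)
  where
  eY : Y (2 + i) ≡ suc (Y (suc i))
  eY = trans (Y-rec hp′ hq′) (cong suc (trans (cong (X p +_) ex) (trans (+-suc (X p) _) (sym (Y-rec hp hq)))))
  hq″ : Ptr Y (suc q) (2 + i)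
  hq″ = hold eY hq′
  eX : X (3 + i) ≡ X (2 + i)
  eX = trans (X-rec hp′ hq″) (sym (X-rec hp hq′))

-- Bounds from unit increments

unit-mono : ∀ {f m} n → m ≤′ n → (∀ j → j < n → Unit f j) → f m ≤ f n
unit-mono n ≤′-refl _ = ≤-refl
unit-mono {f} (suc n) (≤′-step m≤n) h =
  ≤-trans (unit-mono n m≤n (λ j j<n → h j (m<n⇒m<1+n j<n))) (case (h n ≤-refl))
  where
  case : Unit f n → f n ≤ f (suc n)
  case (inj₁ e) = ≤-reflexive (sym e)
  case (inj₂ e) = ≤-trans (n≤1+n _) (≤-reflexive (sym e))

unit-lipschitz : ∀ {f m} n → m ≤′ n → (∀ j → j < n → Unit f j) → f n + m ≤ f m + n
unit-lipschitz n ≤′-refl _ = ≤-refl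
unit-lipschitz {f} {m} (suc n) (≤′-step m≤n) h =
  ≤-trans (+-monoˡ-≤ m (case (h n ≤-refl)))
  (≤-trans (s≤s (unit-lipschitz n m≤n (λ j j<n → h j (m<n⇒m<1+n j<n)))) (≤-reflexive (sym (+-suc (f m) n))))
  where
  case : Unit f n → f (suc n) ≤ suc (f n)
  case (inj₁ e) = ≤-trans (≤-reflexive e) (n≤1+n _)
  case (inj₂ e) = ≤-reflexive e

-- The two kinds of phases

-- With s = first r (below) one has top s r = u_r − 1, 1 + next s r = v_r − 1 and s + r + 2 = a_r;
-- the pointers of phase I start at s, those of phase II end at next s r.
top : ℕ → ℕ → ℕ
top s r = suc (s + s + r)

next : ℕ → ℕ → ℕ
next s r = suc (top s r) + top s r + suc r

-- Besides complementarity where the pointers travel, only values near the right end of that range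
-- enter; they are what stops the pointers.
record PhaseI-Start (s r : ℕ) : Set where
  field
    unitX  : ∀ j → j < suc (top s r) → Unit X j
    unitY  : ∀ j → j < suc (top s r) → Unit Y j
    dual   : ∀ j → s ≤ j → j ≤ top s r → Dual⁺ j
    X-top  : X (top s r) ≡ s + suc r
    Y-top  : Y (top s r) ≡ s + suc r
    X-top⁺ : X (suc (top s r)) ≡ s + suc r
    Y-top⁺ : Y (suc (top s r)) ≡ suc (s + suc r)
    Y-top⁻ : Y (s + s + r) ≡ s + r

record PhaseII-Start (s r : ℕ) : Set where
  private
    U = top s r
    t = next s r
    k = suc r
  field
    unitX : ∀ j → j < suc t → Unit X j
    unitY : ∀ j → j < suc t → Unit Y j
    dual  : ∀ j → U ≤ j → j ≤ t → Dual j
    X-t   : X t ≡ U + k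
    Y-t   : Y t ≡ suc U + k
    X-t⁺  : X (suc t) ≡ suc U + k
    Y-t⁺  : Y (suc t) ≡ suc U + k
    Y-t⁻  : Y (U + U + k) ≡ suc U + k
    X-t⁺⁺ : X (2 + t) ≡ suc (suc U + k)

+-both-max : ∀ {p q e} → p ≤ e → q ≤ e → p + q ≡ e + e → p ≡ e × q ≡ e
+-both-max {p} {q} {e} p≤e q≤e h =
  ≤-antisym p≤e (+-cancelʳ-≤ e e p (≤-trans (≤-reflexive (sym h)) (+-monoʳ-≤ p q≤e))) ,
  ≤-antisym q≤e (+-cancelˡ-≤ e e q (≤-trans (≤-reflexive (sym h)) (+-monoˡ-≤ q p≤e)))

ptrX-value : ∀ {f p q k i} → Ptr f p i → p + q + k ≡ i → f i ≡ q + k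
ptrX-value {p = p} {q} {k} (ptr h) e = +-cancelˡ-≡ p _ _ (trans h (trans (sym e) (+-assoc p q k)))

ptrY-value : ∀ {f q i} p k → Ptr f q i → p + q + k ≡ i → f i ≡ p + k
ptrY-value {q = q} p k h e = ptrX-value h (trans (cong (_+ k) (+-comm q p)) e)

sum-X : ∀ {p q k i} → p + q + k ≡ i → suc p + q + k ≡ suc i
sum-X = cong suc

sum-Y : ∀ {p q k i} → p + q + k ≡ i → p + suc q + k ≡ suc i
sum-Y {p} {q} {k} e = trans (cong (_+ k) (+-suc p q)) (cong suc e)

-- Phase I: from u_r to v_r

module PhaseI (s r : ℕ) (start : PhaseI-Start s r) where
  open PhaseI-Start start

  U e t k y : ℕ
  U = top s r
  e = suc U
  t = next s r
  k = suc r
  y = s + suc r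

  y+y : y + y ≡ U + k
  y+y = lemma s r
    where
    lemma : ∀ s r → s + suc r + (s + suc r) ≡ suc (s + s + r) + suc r
    lemma = solve-∀

  -- If `p` left `e`, `X` would keep the value q + k. But Y e = y + 1 and the Lipschitz bound on
  -- `Y q` force Y q + Y e > q + k.
  X-stops : ∀ {q i} → Ptr X e i → Ptr Y q i → e + q + k ≡ i → q ≤ e → ¬ Ptr X (suc e) (suc i)
  X-stops {q} {i} hp hq sum q≤e hp′ = 1+n≰n (begin
    suc (e + k + q)          ≡⟨ lemma₁ U k q ⟩
    2 + (U + k) + q          ≡⟨ cong (λ z → 2 + z + q) (sym y+y) ⟩
    2 + (y + y) + q          ≡⟨ lemma₂ y q ⟩
    suc y + q + suc y        ≡⟨ sym (cong (λ z → z + q + z) Y-top⁺) ⟩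
    Y e + q + Y e            ≤⟨ +-monoˡ-≤ (Y e) (unit-lipschitz e (≤⇒≤′ q≤e) unitY) ⟩
    Y q + e + Y e            ≡⟨ lemma₃ (Y q) e (Y e) ⟩
    e + (Y q + Y e)          ≡⟨ cong (e +_) (sym (X-rec hp hq)) ⟩
    e + X (suc i)            ≡⟨ cong (e +_) (advance⁻¹ hp hp′) ⟩
    e + X i                  ≡⟨ cong (e +_) (ptrX-value hp sum) ⟩
    e + (q + k)              ≡⟨ lemma₄ e q k ⟩
    e + k + q                ∎)
    where
    open ≤-Reasoning
    lemma₁ : ∀ U k q → suc (suc U + k + q) ≡ 2 + (U + k) + q
    lemma₁ = solve-∀
    lemma₂ : ∀ y q → 2 + (y + y) + q ≡ suc y + q + suc y
    lemma₂ = solve-∀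
    lemma₃ : ∀ a b c → a + b + c ≡ b + (a + c)
    lemma₃ = solve-∀
    lemma₄ : ∀ a b c → a + (b + c) ≡ a + c + b
    lemma₄ = solve-∀

  -- If `q` left `e`, `X` would rise to e + k + 1, while monotonicity gives Y e + Y p ≤ Y e + Y U =
  -- 2y + 1 = e + k.
  Y-stops : ∀ {p i} → Ptr X p i → Ptr Y e i → p + e + k ≡ i → p ≤ U → ¬ Ptr X p (suc i)
  Y-stops {p} {i} hp hq sum p≤U hp′ = 1+n≰n (begin
    suc (e + k)      ≡⟨ cong suc (sym (ptrX-value hp sum)) ⟩
    suc (X i)        ≡⟨ sym (hold⁻¹ hp hp′) ⟩
    X (suc i)        ≡⟨ X-rec hp hq ⟩
    Y e + Y p        ≤⟨ +-monoʳ-≤ (Y e) (unit-mono U (≤⇒≤′ p≤U) (λ j j<U → unitY j (m<n⇒m<1+n j<U))) ⟩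
    Y e + Y U        ≡⟨ cong₂ _+_ Y-top⁺ Y-top ⟩
    suc (y + y)      ≡⟨ cong suc y+y ⟩
    e + k            ∎)
    where open ≤-Reasoning

  -- The field `sum` is invariant because each step moves exactly one pointer.
  record Path (i : ℕ) : Set where
    field
      {p q} : ℕ
      hp    : Ptr X p i
      hq    : Ptr Y q i
      sum   : p + q + k ≡ i
      s≤p   : s ≤ p
      s≤q   : s ≤ q
      p≤e   : p ≤ e
      q≤e   : q ≤ e
      move  : Move p q i

  step : ∀ {i} → i < e + e + k → Path i → Path (suc i)
  step {i} i<V record { p = p ; q = q ; hp = hp ; hq = hq ; sum = sum ; s≤p = s≤p ; s≤q = s≤q
                      ; p≤e = p≤e ; q≤e = q≤e ; move = inj₁ (hp′ , hq′) }
    with m≤n⇒m<n∨m≡n p≤e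
  ... | inj₂ refl = contradiction hp′ (X-stops hp hq sum q≤e)
  ... | inj₁ p<e = record
    { hp = hp′ ; hq = hq′ ; sum = sum-X {p} {q} {k} sum
    ; s≤p = m≤n⇒m≤1+n s≤p ; s≤q = s≤q ; p≤e = p<e ; q≤e = q≤e
    ; move = moveX hp hq (dual p s≤p (s≤s⁻¹ p<e)) hp′ hq′ }
  step {i} i<V record { p = p ; q = q ; hp = hp ; hq = hq ; sum = sum ; s≤p = s≤p ; s≤q = s≤q
                      ; p≤e = p≤e ; q≤e = q≤e ; move = inj₂ (hp′ , hq′ , h) }
    with m≤n⇒m<n∨m≡n q≤e
  ... | inj₂ refl = contradiction hp′ (Y-stops hp hq sum (s≤s⁻¹ p<e))
    where
    -- Before the end p + q < 2e, so q = e leaves p < e.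
    p<e : p < e
    p<e = +-cancelʳ-< e p e (+-cancelʳ-< k (p + e) (e + e) (subst (_< e + e + k) (sym sum) i<V))
  ... | inj₁ q<e = record
    { hp = hp′ ; hq = hq′ ; sum = sum-Y {p} {q} {k} sum
    ; s≤p = s≤p ; s≤q = m≤n⇒m≤1+n s≤q ; p≤e = p≤e ; q≤e = q<e
    ; move = moveY hp hq (dual q s≤q (s≤s⁻¹ q<e)) hp′ hq′ h }

  s≤e : s ≤ e
  s≤e = ≤-trans (m≤m+n s (s + r)) (≤-trans (≤-reflexive (sym (+-assoc s s r))) (≤-trans (n≤1+n _) (n≤1+n _)))

  path₀ : Path U
  path₀ = record
    { hp = hp ; hq = hq ; sum = +-suc (s + s) r ; s≤p = ≤-refl ; s≤q = ≤-refl ; p≤e = s≤e ; q≤e = s≤e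
    ; move = inj₁ (advance (trans X-top⁺ (sym X-top)) hp , hold (trans Y-top⁺ (cong suc (sym Y-top))) hq) }
    where
    lemma : ∀ s r → s + (s + suc r) ≡ suc (s + s + r)
    lemma = solve-∀
    hp : Ptr X s U
    hp = ptr (trans (cong (s +_) X-top) (lemma s r))
    hq : Ptr Y s U
    hq = ptr (trans (cong (s +_) Y-top) (lemma s r))

  path′ : ∀ n → n + U ≤ e + e + k → Path (n + U)
  path′ zero _ = path₀
  path′ (suc n) h = step h (path′ n (<⇒≤ h))

  path : ∀ {i} → U ≤ i → i ≤ e + e + k → Path i
  path {i} U≤i i≤V =
    subst Path (m∸n+n≡m U≤i) (path′ (i ∸ U) (≤-trans (≤-reflexive (m∸n+n≡m U≤i)) i≤V))

  V≡1+t : e + e + k ≡ suc t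
  V≡1+t = lemma U k
    where
    lemma : ∀ U k → suc U + suc U + k ≡ suc (suc U + U + k)
    lemma = solve-∀

  U≤U+U+k : U ≤ U + U + k
  U≤U+U+k = ≤-trans (m≤m+n U U) (m≤m+n (U + U) k)

  -- Just before the end it is p that reaches e first.
  X-V-2 : suc (X (U + U + k)) ≡ U + k
  X-V-2 = trans (cong (suc ∘ X) (sym 1+j≡)) (case (path U≤j j≤V))
    where
    j : ℕ
    j = U + U + r
    1+j≡ : suc j ≡ U + U + k
    1+j≡ = sym (+-suc (U + U) r)
    U≤j : U ≤ j
    U≤j = ≤-trans (m≤m+n U U) (m≤m+n (U + U) r)
    j<V : j < e + e + k
    j<V = ≤-trans (≤-reflexive 1+j≡) (≤-trans (n≤1+n _) (≤-trans (n≤1+n _) (≤-reflexive (sym V≡1+t))))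
    j≤V : j ≤ e + e + k
    j≤V = <⇒≤ j<V
    case : Path j → suc (X (suc j)) ≡ U + k
    case record { p = p ; q = q ; hp = hp ; hq = hq ; sum = sum ; p≤e = p≤e ; q≤e = q≤e ; move = move } = goal
      where
      open ≤-Reasoning
      -- The index `j` lies three before the end, where (p, q) is one of (e, U - 2), (U, U - 1), (U
      -- - 1, U), (U - 2, e). The first three give the same value of `X`.
      1+p+q : suc (p + q) ≡ U + U
      1+p+q = +-cancelʳ-≡ r _ _ (trans (sym (+-suc (p + q) r)) sum)
      Yp+Yq : ∀ {p q} → Y q ≡ y → Y p ≡ s + r → suc (Y q + Y p) ≡ U + k
      Yp+Yq eq ep = trans (cong suc (cong₂ _+_ eq ep))
        (trans (sym (trans (cong (y +_) (+-suc s r)) (+-suc y _))) y+y)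
      lower : q + k ≤ X (suc j)
      lower = lower′ move
        where
        lower′ : Move p q j → q + k ≤ X (suc j)
        lower′ (inj₁ (hp′ , _)) = ≤-reflexive (sym (trans (advance⁻¹ hp hp′) (ptrX-value hp sum)))
        lower′ (inj₂ (hp′ , _)) = ≤-trans (n≤1+n _)
          (≤-reflexive (sym (trans (hold⁻¹ hp hp′) (cong suc (ptrX-value hp sum)))))
      goal : suc (X (suc j)) ≡ U + k
      goal with m≤n⇒m<n∨m≡n p≤e
      ... | inj₂ refl = at-e move
        where
        2+q : 2 + q ≡ U
        2+q = +-cancelˡ-≡ U _ _ (trans (+-suc U (suc q)) (trans (cong suc (+-suc U q)) 1+p+q))
        at-e : Move e q j → suc (X (suc j)) ≡ U + k
        at-e (inj₁ (hp′ , _)) = contradiction hp′ (X-stops hp hq sum q≤e)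
        at-e (inj₂ (hp′ , _)) =
          trans (cong suc (trans (hold⁻¹ hp hp′) (cong suc (ptrX-value hp sum)))) (cong (_+ k) 2+q)
      ... | inj₁ p<e with m≤n⇒m<n∨m≡n (s≤s⁻¹ p<e)
      ... | inj₂ refl = trans (cong suc (trans (X-rec hp hq) (+-comm (Y q) (Y U))))
          (Yp+Yq {q} {U} Y-top (trans (cong Y (suc-injective 1+q)) Y-top⁻))
        where
        1+q : suc q ≡ U
        1+q = +-cancelˡ-≡ U _ _ (trans (+-suc U q) 1+p+q)
      ... | inj₁ p<U with m≤n⇒m<n∨m≡n (s≤s⁻¹ p<U)
      ... | inj₂ refl = trans (cong suc (X-rec hp hq))
          (Yp+Yq {p} {q} (trans (cong Y (+-cancelˡ-≡ U _ _ 1+p+q)) Y-top) Y-top⁻)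
      -- Here q = e. The path demands X (j + 1) ≥ e + k, but the recurrence gives at most Y e + Y (U
      -- - 1) = 2y = U + k.
      ... | inj₁ p<U⁻ = contradiction (begin
          suc (suc (y + y))      ≡⟨ cong (2 +_) y+y ⟩
          suc (e + k)            ≤⟨ s≤s (+-monoˡ-≤ k e≤q) ⟩
          suc (q + k)            ≤⟨ s≤s lower ⟩
          suc (X (suc j))        ≡⟨ cong suc (X-rec hp hq) ⟩
          suc (Y q + Y p)        ≡⟨ cong (λ z → suc (Y z + Y p)) (≤-antisym q≤e e≤q) ⟩
          suc (Y e + Y p)        ≤⟨ s≤s (+-monoʳ-≤ (Y e) (unit-mono (s + s + r) (≤⇒≤′ (<⇒≤ p<U⁻))
                                       (λ j h → unitY j (m<n⇒m<1+n (m<n⇒m<1+n h))))) ⟩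
          suc (Y e + Y (s + s + r)) ≡⟨ sym (+-suc (Y e) _) ⟩
          Y e + suc (Y (s + s + r)) ≡⟨ cong₂ _+_ Y-top⁺ (trans (cong suc Y-top⁻) (sym (+-suc s r))) ⟩
          suc (y + y)            ∎) 1+n≰n
        where
        e≤q : e ≤ q
        e≤q = +-cancelˡ-≤ U e q (begin
          U + suc U              ≡⟨ +-suc U U ⟩
          suc (U + U)            ≡⟨ cong suc (sym 1+p+q) ⟩
          2 + p + q              ≤⟨ +-monoˡ-≤ q (s≤s p<U⁻) ⟩
          U + q                  ∎)

  Path-dual : ∀ {i} → Path i → Dual i
  Path-dual record { hp = hp ; hq = hq ; move = inj₁ (hp′ , hq′) } = inj₁ (advance⁻¹ hp hp′ , hold⁻¹ hq hq′)
  Path-dual record { hp = hp ; hq = hq ; move = inj₂ (hp′ , hq′ , _) } = inj₂ (hold⁻¹ hp hp′ , advance⁻¹ hq hq′)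

  -- `Ptr` determines its pointer, so the path has p = e, and `X-stops` leaves only the move of `q`.
  X-at-e : ∀ {i} → Ptr X e i → Path i → Y i ≡ e + k × X (suc i) ≡ suc (X i) × Y (suc i) ≡ Y i
  X-at-e {i} he record { p = p ; hp = hp ; hq = hq ; sum = sum ; q≤e = q≤e ; move = move }
    with +-cancelʳ-≡ (X i) p e (trans (split hp) (sym (split he)))
  ... | refl with move
  ...   | inj₁ (hp′ , _)       = contradiction hp′ (X-stops hp hq sum q≤e)
  ...   | inj₂ (hp′ , hq′ , _) = ptrY-value e k hq sum , hold⁻¹ hp hp′ , advance⁻¹ hq hq′

  end : PhaseII-Start s r
  end = record
    { unitX = λ j j≤t → [ (λ j<U → unitX j (m<n⇒m<1+n j<U))
                        , (λ U≤j → Dual-unitX (dual′ U≤j (s≤s⁻¹ j≤t))) ]′ (<-≤-connex j U)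
    ; unitY = λ j j≤t → [ (λ j<U → unitY j (m<n⇒m<1+n j<U))
                        , (λ U≤j → Dual-unitY (dual′ U≤j (s≤s⁻¹ j≤t))) ]′ (<-≤-connex j U)
    ; dual  = λ j → dual′
    ; X-t   = X-t
    ; Y-t   = Y-t
    ; X-t⁺  = X-t⁺
    ; Y-t⁺  = Y-t⁺
    ; Y-t⁻  = proj₁ at₀
    -- Both pointers now stand at `e`. This further value fixes the first move of phase II.
    ; X-t⁺⁺ = trans (X-rec pX₂ pY₂) (trans (cong₂ _+_ Y-top⁺ Y-top⁺)
                    (cong suc (trans (+-suc y y) (cong suc y+y))))
    }
    where
    Dual-unitX : ∀ {j} → Dual j → Unit X j
    Dual-unitX = [ inj₁ ∘ proj₁ , inj₂ ∘ proj₁ ]′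
    Dual-unitY : ∀ {j} → Dual j → Unit Y j
    Dual-unitY = [ inj₂ ∘ proj₂ , inj₁ ∘ proj₂ ]′
    t≤V : t ≤ e + e + k
    t≤V = ≤-trans (n≤1+n t) (≤-reflexive (sym V≡1+t))
    dual′ : ∀ {j} → U ≤ j → j ≤ t → Dual j
    dual′ U≤j j≤t = Path-dual (path U≤j (≤-trans j≤t t≤V))
    -- From here `p` rests at `e` while `q` makes its last two moves, from U - 1 to `U` to `e`.
    pX₀ : Ptr X e (U + U + k)
    pX₀ = ptr (trans (sym (+-suc U _)) (trans (cong (U +_) X-V-2) (sym (+-assoc U U k))))
    at₀ : Y (U + U + k) ≡ e + k × X t ≡ suc (X (U + U + k)) × Y t ≡ Y (U + U + k)
    at₀ = X-at-e pX₀ (path U≤U+U+k (≤-trans (n≤1+n _) t≤V))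
    pX₁ : Ptr X e t
    pX₁ = hold (proj₁ (proj₂ at₀)) pX₀
    at₁ : Y t ≡ e + k × X (suc t) ≡ suc (X t) × Y (suc t) ≡ Y t
    at₁ = X-at-e pX₁ (path (≤-trans U≤U+U+k (n≤1+n _)) t≤V)
    pX₂ : Ptr X e (suc t)
    pX₂ = hold (proj₁ (proj₂ at₁)) pX₁
    X-t : X t ≡ U + k
    X-t = trans (proj₁ (proj₂ at₀)) X-V-2
    Y-t : Y t ≡ e + k
    Y-t = proj₁ at₁
    X-t⁺ : X (suc t) ≡ e + k
    X-t⁺ = trans (proj₁ (proj₂ at₁)) (cong suc X-t)
    Y-t⁺ : Y (suc t) ≡ e + k
    Y-t⁺ = trans (proj₂ (proj₂ at₁)) Y-t
    pY₂ : Ptr Y e (suc t)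
    pY₂ = ptr (trans (cong (e +_) Y-t⁺) (trans (sym (+-assoc e e k)) V≡1+t))

-- Phase II: from v_r to u_{r+1}

module PhaseII (s r : ℕ) (start : PhaseII-Start s r) where
  open PhaseII-Start start

  U e t k : ℕ
  U = top s r
  e = suc U
  t = next s r
  k = suc r

  -- A move of `p` goes with a rest of `q`, hence with a rise of `Y` to t + k + 1; monotonicity
  -- bounds `Y` by 1 + 2 X t = t + k.
  X-stops : ∀ {q i} → Ptr X t (suc i) → Ptr Y q i → t + q + k ≡ i → q < t → ¬ Ptr Y q (suc i)
  X-stops {q} {i} hp hq sum q<t hq′ = 1+n≰n (begin
    suc (t + k)               ≡⟨ cong suc (sym (ptrY-value t k hq sum)) ⟩
    suc (Y i)                 ≡⟨ sym (hold⁻¹ hq hq′) ⟩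
    Y (suc i)                 ≡⟨ Y-rec hp hq ⟩
    suc (X t + X (suc q))     ≤⟨ s≤s (+-monoʳ-≤ (X t) (unit-mono t (≤⇒≤′ q<t)
                                   (λ j j<t → unitX j (m<n⇒m<1+n j<t)))) ⟩
    suc (X t + X t)           ≡⟨ cong (λ z → suc (z + z)) X-t ⟩
    suc (U + k + (U + k))     ≡⟨ lemma U k ⟩
    t + k                     ∎)
    where
    open ≤-Reasoning
    lemma : ∀ U k → suc (U + k + (U + k)) ≡ suc U + U + k + k
    lemma = solve-∀

  -- A move of `q` would leave `Y` at p + k, but X (t + 1) = e + k and the Lipschitz bound on `X p`
  -- make the recurrence exceed this.
  Y-stops : ∀ {p i} → Ptr X p (suc i) → Ptr Y t i → p + t + k ≡ i → p ≤ t → ¬ Ptr Y (suc t) (suc i)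
  Y-stops {p} {i} hp hq sum p≤t hq′ = 1+n≰n (begin
    suc (t + suc k + p)                    ≡⟨ lemma₁ U k p ⟩
    suc (e + k) + (e + k + p)              ≡⟨ sym (cong (λ z → suc z + (z + p)) X-t⁺) ⟩
    suc (X (suc t)) + (X (suc t) + p)      ≤⟨ +-monoʳ-≤ (suc (X (suc t)))
                                                (unit-lipschitz (suc t) (≤⇒≤′ (m≤n⇒m≤1+n p≤t)) unitX) ⟩
    suc (X (suc t)) + (X p + suc t)        ≡⟨ lemma₂ (X (suc t)) (X p) t ⟩
    suc (X p + X (suc t)) + suc t          ≡⟨ cong (_+ suc t) (sym (Y-rec hp hq)) ⟩
    Y (suc i) + suc t                      ≡⟨ cong (_+ suc t) (trans (advance⁻¹ hq hq′) (ptrY-value p k hq sum)) ⟩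
    p + k + suc t                          ≡⟨ lemma₃ p k t ⟩
    t + suc k + p                          ∎)
    where
    open ≤-Reasoning
    lemma₁ : ∀ U k p → suc (suc U + U + k + suc k + p) ≡ suc (suc U + k) + (suc U + k + p)
    lemma₁ = solve-∀
    lemma₂ : ∀ a b t → suc a + (b + suc t) ≡ suc (b + a) + suc t
    lemma₂ = solve-∀
    lemma₃ : ∀ p k t → p + k + suc t ≡ t + suc k + p
    lemma₃ = solve-∀

  record Path (i : ℕ) : Set where
    field
      {p q} : ℕ
      hp    : Ptr X p (suc i)
      hq    : Ptr Y q i
      sum   : p + q + k ≡ i
      U≤p   : U ≤ p
      U≤q   : U ≤ q
      p≤t   : p ≤ t
      q≤t   : q ≤ t
      move  : Move⁺ p q i

  step : ∀ {i} → i < t + t + k → Path i → Path (suc i)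
  step {i} i<end record { p = p ; q = q ; hp = hp ; hq = hq ; sum = sum ; U≤p = U≤p ; U≤q = U≤q
                        ; p≤t = p≤t ; q≤t = q≤t ; move = inj₁ (hp′ , hq′ , h) }
    with m≤n⇒m<n∨m≡n p≤t
  ... | inj₂ refl = contradiction hq′ (X-stops hp hq sum q<t)
    where
    q<t : q < t
    q<t = +-cancelˡ-< t q t (+-cancelʳ-< k (t + q) (t + t) (subst (_< t + t + k) (sym sum) i<end))
  ... | inj₁ p<t = record
    { hp = hp′ ; hq = hq′ ; sum = sum-X {p} {q} {k} sum
    ; U≤p = m≤n⇒m≤1+n U≤p ; U≤q = U≤q ; p≤t = p<t ; q≤t = q≤t
    ; move = moveX⁺ hp hq (dual p U≤p p≤t) hp′ hq′ h }
  step {i} i<end record { p = p ; q = q ; hp = hp ; hq = hq ; sum = sum ; U≤p = U≤p ; U≤q = U≤q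
                        ; p≤t = p≤t ; q≤t = q≤t ; move = inj₂ (hp′ , hq′) }
    with m≤n⇒m<n∨m≡n q≤t
  ... | inj₂ refl = contradiction hq′ (Y-stops hp hq sum p≤t)
  ... | inj₁ q<t = record
    { hp = hp′ ; hq = hq′ ; sum = sum-Y {p} {q} {k} sum
    ; U≤p = U≤p ; U≤q = m≤n⇒m≤1+n U≤q ; p≤t = p≤t ; q≤t = q<t
    ; move = moveY⁺ hp hq (dual (suc q) (m≤n⇒m≤1+n U≤q) q<t) hp′ hq′ }

  path₀ : Path t
  path₀ = record
    { hp = hp ; hq = hq ; sum = refl ; U≤p = n≤1+n U ; U≤q = ≤-refl
    ; p≤t = ≤-trans (m≤m+n e U) (m≤m+n (e + U) k) ; q≤t = ≤-trans (m≤n+m U e) (m≤m+n (e + U) k)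
    ; move = inj₂ (hold (trans X-t⁺⁺ (cong suc (sym X-t⁺))) hp , advance (trans Y-t⁺ (sym Y-t)) hq) }
    where
    lemma₁ : ∀ U k → suc U + (suc U + k) ≡ suc (suc U + U + k)
    lemma₁ = solve-∀
    lemma₂ : ∀ U k → U + (suc U + k) ≡ suc U + U + k
    lemma₂ = solve-∀
    hp : Ptr X e (suc t)
    hp = ptr (trans (cong (e +_) X-t⁺) (lemma₁ U k))
    hq : Ptr Y U t
    hq = ptr (trans (cong (U +_) Y-t) (lemma₂ U k))

  path′ : ∀ n → n + t ≤ t + t + k → Path (n + t)
  path′ zero _ = path₀
  path′ (suc n) h = step h (path′ n (<⇒≤ h))

  path : ∀ {i} → t ≤ i → i ≤ t + t + k → Path i
  path {i} t≤i i≤end =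
    subst Path (m∸n+n≡m t≤i) (path′ (i ∸ t) (≤-trans (≤-reflexive (m∸n+n≡m t≤i)) i≤end))

  Path-dual : ∀ {i} → Path i → Dual⁺ i
  Path-dual record { hp = hp ; hq = hq ; move = inj₁ (hp′ , hq′ , _) } = inj₂ (hold⁻¹ hq hq′ , advance⁻¹ hp hp′)
  Path-dual record { hp = hp ; hq = hq ; move = inj₂ (hp′ , hq′) } = inj₁ (advance⁻¹ hq hq′ , hold⁻¹ hp hp′)

  N : ℕ
  N = t + t + k

  t≤N : t ≤ N
  t≤N = ≤-trans (m≤m+n t t) (m≤m+n (t + t) k)

  twice : suc U + k + (suc U + k) ≡ suc (t + k)
  twice = lemma U k
    where
    lemma : ∀ U k → suc U + k + (suc U + k) ≡ suc (suc U + U + k + k)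
    lemma = solve-∀

  -- Two steps before `N` one has p + q = 2t₀ with t₀ = t - 1. If p ≥ t₀, both terms of `X-rec` lie
  -- on the plateau Y t₀ = Y t = e + k. If p < t₀, then q = t, and `Y-stops` forces `X` to stay
  -- constant.
  X-N : X N ≡ suc (t + k)
  X-N = trans (cong X (sym 2+j≡)) (case (path t≤j (≤-trans (≤-trans (n≤1+n _) (n≤1+n _)) (≤-reflexive 2+j≡))))
    where
    t₀ j : ℕ
    t₀ = U + U + k
    j = t₀ + t + r
    2+j≡ : 2 + j ≡ N
    2+j≡ = sym (+-suc (t + t) r)
    t≤j : t ≤ j
    t≤j = ≤-trans (m≤n+m t t₀) (m≤m+n (t₀ + t) r)
    case : Path j → X (2 + j) ≡ suc (t + k)
    case record { p = p ; q = q ; hp = hp ; hq = hq ; sum = sum ; p≤t = p≤t ; q≤t = q≤t ; move = move } = goal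
      where
      open ≤-Reasoning
      p+q : p + q ≡ t₀ + t₀
      p+q = suc-injective (trans (+-cancelʳ-≡ r _ _ (trans (sym (+-suc (p + q) r)) sum)) (+-suc t₀ t₀))
      Yq+Yp : ∀ {a b} → Y a ≡ e + k → Y b ≡ e + k → Y a + Y b ≡ suc (t + k)
      Yq+Yp ea eb = trans (cong₂ _+_ ea eb) twice
      goal : X (2 + j) ≡ suc (t + k)
      goal with m≤n⇒m<n∨m≡n p≤t
      ... | inj₂ refl = at-t move
        where
        1+q : suc q ≡ t₀
        1+q = +-cancelˡ-≡ t₀ _ _ (trans (+-suc t₀ q) p+q)
        at-t : Move⁺ t q j → X (2 + j) ≡ suc (t + k)
        at-t (inj₁ (hp′ , hq′ , _)) = contradiction hq′ (X-stops hp hq sum (≤-trans (≤-reflexive 1+q) (n≤1+n t₀)))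
        at-t (inj₂ (hp′ , hq′)) = trans (X-rec hp hq′) (Yq+Yp {suc q} {t} (trans (cong Y 1+q) Y-t⁻) Y-t)
      ... | inj₁ p<t with m≤n⇒m<n∨m≡n (s≤s⁻¹ p<t)
      ... | inj₂ refl = at-t₀ move
        where
        q≡ : q ≡ t₀
        q≡ = +-cancelˡ-≡ t₀ _ _ p+q
        at-t₀ : Move⁺ t₀ q j → X (2 + j) ≡ suc (t + k)
        at-t₀ (inj₁ (hp′ , hq′ , _)) = trans (X-rec hp hq′) (Yq+Yp {q} {t₀} (trans (cong Y q≡) Y-t⁻) Y-t⁻)
        at-t₀ (inj₂ (hp′ , hq′)) = trans (X-rec hp hq′) (Yq+Yp {suc q} {t₀} (trans (cong (Y ∘ suc) q≡) Y-t) Y-t⁻)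
      ... | inj₁ p<t₀ = at-low move
        where
        q≡ : q ≡ t
        q≡ = ≤-antisym q≤t (+-cancelˡ-≤ t₀ t q (begin
          t₀ + t           ≡⟨ +-suc t₀ t₀ ⟩
          suc (t₀ + t₀)    ≡⟨ cong suc (sym p+q) ⟩
          suc p + q        ≤⟨ +-monoˡ-≤ q p<t₀ ⟩
          t₀ + q           ∎))
        at-low : Move⁺ p q j → X (2 + j) ≡ suc (t + k)
        at-low (inj₁ (hp′ , hq′ , _)) = trans (advance⁻¹ hp hp′)
          (trans (ptrX-value hp (sum-Y {p} {q} {k} sum)) (cong (λ z → suc (z + k)) q≡))
        at-low (inj₂ (hp′ , hq′)) = contradiction (subst (λ z → Ptr Y (suc z) (suc j)) q≡ hq′)
          (Y-stops hp (subst (λ z → Ptr Y z j) q≡ hq) (subst (λ z → p + z + k ≡ j) q≡ sum) p≤t)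

  -- The invariant reads p + q = 2t, and neither pointer exceeds `t`.
  at-N : Ptr X t (suc N) × Ptr Y t N
  at-N = case (path t≤N ≤-refl)
    where
    case : Path N → Ptr X t (suc N) × Ptr Y t N
    case record { hp = hp ; hq = hq ; sum = sum ; p≤t = p≤t ; q≤t = q≤t }
      with +-both-max p≤t q≤t (+-cancelʳ-≡ k _ _ sum)
    ... | refl , refl = hp , hq

  X-N⁺ : X (suc N) ≡ suc (t + k)
  X-N⁺ = ptrX-value (proj₁ at-N) (sum-Y {t} {t} {k} refl)

  Y-N : Y N ≡ t + k
  Y-N = ptrY-value t k (proj₂ at-N) refl

  -- The next phase I asks for `Dual⁺` at N + 1, one index beyond the path. The values up to X (N +
  -- 3) are therefore computed singly from the pointers.
  Y-N⁺ : Y (suc N) ≡ suc (t + k)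
  Y-N⁺ = trans (Y-rec (proj₁ at-N) (proj₂ at-N)) (cong suc (trans (cong₂ _+_ X-t X-t⁺) (suc-injective twice)))

  hq₁ : Ptr Y t (suc N)
  hq₁ = hold (trans Y-N⁺ (cong suc (sym Y-N))) (proj₂ at-N)

  X-N⁺⁺ : X (2 + N) ≡ suc (t + k)
  X-N⁺⁺ = trans (X-rec (proj₁ at-N) hq₁) (trans (cong₂ _+_ Y-t Y-t) twice)

  hp₂ : Ptr X (suc t) (2 + N)
  hp₂ = advance (trans X-N⁺⁺ (sym X-N⁺)) (proj₁ at-N)

  Y-N⁺⁺ : Y (2 + N) ≡ suc (suc (t + k))
  Y-N⁺⁺ = trans (Y-rec hp₂ hq₁) (cong suc (trans (cong₂ _+_ X-t⁺ X-t⁺) twice))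

  hq₂ : Ptr Y t (2 + N)
  hq₂ = hold (trans Y-N⁺⁺ (cong suc (sym Y-N⁺))) hq₁

  X-N⁺⁺⁺ : X (3 + N) ≡ suc (t + k)
  X-N⁺⁺⁺ = trans (X-rec hp₂ hq₂) (trans (cong₂ _+_ Y-t Y-t⁺) twice)

  end : PhaseI-Start t k
  end = record
    { unitX  = λ j j≤ → [ unitX j , (λ t<j → pred-unit t<j j≤) ]′ (<-≤-connex j (suc t))
    ; unitY  = λ j j≤ → [ (λ j<t → unitY j (m<n⇒m<1+n j<t))
                        , (λ t≤j → Dual⁺-unitY (dual′ t≤j (s≤s⁻¹ j≤))) ]′ (<-≤-connex j t)
    ; dual   = λ j → dual′
    ; X-top  = trans X-N⁺ (sym (+-suc t k))
    ; Y-top  = trans Y-N⁺ (sym (+-suc t k))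
    ; X-top⁺ = trans X-N⁺⁺ (sym (+-suc t k))
    ; Y-top⁺ = trans Y-N⁺⁺ (cong suc (sym (+-suc t k)))
    ; Y-top⁻ = Y-N
    }
    where
    Dual⁺-unitX : ∀ {j} → Dual⁺ j → Unit X (suc j)
    Dual⁺-unitX = [ inj₂ ∘ proj₂ , inj₁ ∘ proj₂ ]′
    Dual⁺-unitY : ∀ {j} → Dual⁺ j → Unit Y j
    Dual⁺-unitY = [ inj₁ ∘ proj₁ , inj₂ ∘ proj₁ ]′
    dual′ : ∀ {j} → t ≤ j → j ≤ suc N → Dual⁺ j
    dual′ t≤j j≤1+N with m≤n⇒m<n∨m≡n j≤1+N
    ... | inj₂ refl = inj₂ (trans Y-N⁺⁺ (cong suc (sym Y-N⁺)) , trans X-N⁺⁺⁺ (sym X-N⁺⁺))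
    ... | inj₁ j<1+N = Path-dual (path t≤j (s≤s⁻¹ j<1+N))
    pred-unit : ∀ {j} → suc t ≤ j → j < 2 + N → Unit X j
    pred-unit (s≤s t≤j) j<2+N = Dual⁺-unitX (dual′ t≤j (≤-trans (n≤1+n _) (s≤s⁻¹ j<2+N)))

-- Induction over the phases

-- This is a_r - r - 2, see `a-value`.
first : ℕ → ℕ
first zero    = 1
first (suc r) = next (first r) r

phaseI-start : ∀ r → PhaseI-Start (first r) r
phaseI-start zero with X-values | Y-values
... | X0 , X1 , X2 , X3 , X4 , X5 | Y0 , Y1 , Y2 , Y3 , Y4 = record
  { unitX  = uX
  ; unitY  = uY
  ; dual   = d
  ; X-top  = X3
  ; Y-top  = Y3
  ; X-top⁺ = X4
  ; Y-top⁺ = Y4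
  ; Y-top⁻ = Y2
  }
  where
  uX : ∀ j → j < 4 → Unit X j
  uX 0 _ = inj₁ (trans X1 (sym X0))
  uX 1 _ = inj₂ (trans X2 (cong suc (sym X1)))
  uX 2 _ = inj₂ (trans X3 (cong suc (sym X2)))
  uX 3 _ = inj₁ (trans X4 (sym X3))
  uX (suc (suc (suc (suc _)))) (s≤s (s≤s (s≤s (s≤s ()))))
  uY : ∀ j → j < 4 → Unit Y j
  uY 0 _ = inj₂ (trans Y1 (cong suc (sym Y0)))
  uY 1 _ = inj₁ (trans Y2 (sym Y1))
  uY 2 _ = inj₂ (trans Y3 (cong suc (sym Y2)))
  uY 3 _ = inj₂ (trans Y4 (cong suc (sym Y3)))
  uY (suc (suc (suc (suc _)))) (s≤s (s≤s (s≤s (s≤s ()))))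
  d : ∀ j → 1 ≤ j → j ≤ 3 → Dual⁺ j
  d 1 _ _ = inj₁ (trans Y2 (sym Y1) , trans X3 (cong suc (sym X2)))
  d 2 _ _ = inj₂ (trans Y3 (cong suc (sym Y2)) , trans X4 (sym X3))
  d 3 _ _ = inj₂ (trans Y4 (cong suc (sym Y3)) , trans X5 (sym X4))
  d (suc (suc (suc (suc _)))) _ (s≤s (s≤s (s≤s ())))
phaseI-start (suc r) = PhaseII.end (first r) r (PhaseI.end (first r) r (phaseI-start r))

phaseII-start : ∀ r → PhaseII-Start (first r) r
phaseII-start r = PhaseI.end (first r) r (phaseI-start r)

-- Since `top s i` is at least `i`, the start of phase I number `i` already covers index `i`.
unitX : ∀ i → Unit X i
unitX i = PhaseI-Start.unitX (phaseI-start i) i (m<n⇒m<1+n (s≤s (m≤n+m i _)))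

unitY : ∀ i → Unit Y i
unitY i = PhaseI-Start.unitY (phaseI-start i) i (m<n⇒m<1+n (s≤s (m≤n+m i _)))

unit-ptr : ∀ {f} → f 0 ≡ 0 → (∀ i → Unit f i) → ∀ i → ∃ λ p → Ptr f p i
unit-ptr e h zero = 0 , ptr e
unit-ptr e h (suc i) with unit-ptr e h i | h i
... | p , hp | inj₁ e′ = suc p , advance e′ hp
... | p , hp | inj₂ e′ = p , hold e′ hp

ptrX : ∀ i → ∃ λ p → Ptr X p i
ptrX = unit-ptr (proj₁ X-values) unitX

ptrY : ∀ i → ∃ λ q → Ptr Y q i
ptrY = unit-ptr (proj₁ Y-values) unitY

-- The recursion for Q̃

import Data.Integer as ℤ
import Data.Integer.Properties as ℤ
import Data.Integer.DivMod as ℤD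
import Data.Nat.DivMod as ℕD
open import Data.Integer using (ℤ; +_)
open import Data.List using (List; []; _∷_; _++_; length; lookup)
open import Data.List.Properties using (length-++)
open import Data.Fin using (fromℕ<)

lookup-++ : ∀ (l ys : List ℤ) {k} (h : k < length l) (h′ : k < length (l ++ ys)) →
            lookup (l ++ ys) (fromℕ< h′) ≡ lookup l (fromℕ< h)
lookup-++ (x ∷ l) ys {zero} h h′ = refl
lookup-++ (x ∷ l) ys {suc k} h h′ = lookup-++ l ys (s<s⁻¹ h) (s<s⁻¹ h′)

lookup-last : ∀ (l : List ℤ) x (h : length l < length (l ++ x ∷ [])) → lookup (l ++ x ∷ []) (fromℕ< h) ≡ x
lookup-last [] x h = refl
lookup-last (_ ∷ l) x h = lookup-last l x (s<s⁻¹ h)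

length-snoc : ∀ (l : List ℤ) x → length (l ++ x ∷ []) ≡ suc (length l)
length-snoc l x = trans (length-++ l) (+-comm (length l) 1)

getQ-++ : ∀ l x {k} → k < length l → getQ (l ++ x ∷ []) (+ suc k) ≡ getQ l (+ suc k)
getQ-++ l x {k} k<l with k <? length (l ++ x ∷ []) | k <? length l
... | yes h | yes h′ = lookup-++ l (x ∷ []) h′ h
... | no ¬h | _      = contradiction (≤-trans (m<n⇒m<1+n k<l) (≤-reflexive (sym (length-snoc l x)))) ¬h
... | _     | no ¬h  = contradiction k<l ¬h

getQ-last : ∀ l x {k} → k ≡ length l → getQ (l ++ x ∷ []) (+ suc k) ≡ x
getQ-last l x refl with length l <? length (l ++ x ∷ [])
... | yes h = lookup-last l x h
... | no ¬h = contradiction (≤-reflexive (sym (length-snoc l x))) ¬h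

qlist-snoc : ∀ n → ∃ λ x → qlist (suc n) ≡ qlist n ++ x ∷ []
qlist-snoc zero          = _ , refl
qlist-snoc (suc zero)    = _ , refl
qlist-snoc (suc (suc n)) = _ , refl

length-qlist : ∀ n → length (qlist n) ≡ n
length-qlist zero = refl
length-qlist (suc n) with qlist-snoc n
... | x , e = trans (cong length e) (trans (length-snoc (qlist n) x) (cong suc (length-qlist n)))

-- Passing to a longer list only appends an entry, so values once computed persist.
getQ-qlist : ∀ {k} n → suc k ≤′ n → getQ (qlist n) (+ suc k) ≡ Qt (suc k)
getQ-qlist n ≤′-refl = refl
getQ-qlist {k} (suc n) (≤′-step h) with qlist-snoc n
... | x , e = trans (cong (λ l → getQ l (+ suc k)) e)
             (trans (getQ-++ (qlist n) x (≤-trans (≤′⇒≤ h) (≤-reflexive (sym (length-qlist n))))) (getQ-qlist n h))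

-- The form `suc w` and the upper bounds keep both look-ups inside the list, so the default 0 of
-- `getQ` is never met.
Qt-rec : ∀ {m y y′ w w′} → Qt (2 + m) ≡ + y → Qt (1 + m) ≡ + y′ →
         y + suc w ≡ 3 + m → y′ + suc w′ ≡ 3 + m → suc w ≤ 2 + m → suc w′ ≤ 2 + m →
         Qt (3 + m) ≡ Qt (suc w) ℤ.+ Qt (suc w′) ℤ.+ sgn (3 + m)
Qt-rec {m} {y} {y′} {w} {w′} e e′ h h′ w≤ w′≤ =
  trans (getQ-last (qlist (2 + m)) _ (sym (length-qlist (2 + m))))
        (cong (ℤ._+ sgn (3 + m)) (cong₂ ℤ._+_ (at e h w≤)
          (at (trans (getQ-qlist (2 + m) (≤′-step ≤′-refl)) e′) h′ w′≤)))
  where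
  index : ∀ {y w} → y + suc w ≡ 3 + m → (+ (3 + m)) ℤ.- (+ y) ≡ + suc w
  index {y} {w} h = trans (ℤ.m-n≡m⊖n (3 + m) y) (trans (cong (ℤ._⊖ y) (sym (trans (+-comm (suc w) y) h)))
    (trans (ℤ.⊖-≥ (m≤n+m y (suc w))) (cong +_ (m+n∸n≡m (suc w) y))))
  at : ∀ {z y w} → z ≡ + y → y + suc w ≡ 3 + m → suc w ≤ 2 + m →
       getQ (qlist (2 + m)) ((+ (3 + m)) ℤ.- z) ≡ Qt (suc w)
  at {y = y} {w} refl h w≤ = trans (cong (getQ (qlist (2 + m))) (index {y} {w} h)) (getQ-qlist (2 + m) (≤⇒≤′ w≤))

-- Splitting the recursion by parity

sgn-even : ∀ n → sgn (n + n) ≡ + 1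
sgn-even zero = refl
sgn-even (suc n) rewrite +-suc n n = trans (ℤ.neg-involutive _) (sgn-even n)

Odd Even : ℕ → Set
Odd i  = Qt (suc (i + i)) ≡ + suc (X i + X i)
Even i = Qt (2 + (i + i)) ≡ + suc (Y i + Y i)

≤-extend : ∀ {P : ℕ → Set} {n} → (∀ i → i ≤ n → P i) → P (suc n) → ∀ i → i ≤ suc n → P i
≤-extend h e i i≤1+n with m≤n⇒m<n∨m≡n i≤1+n
... | inj₁ i<1+n = h i (s≤s⁻¹ i<1+n)
... | inj₂ refl  = e

double-split : ∀ {f p i} → Ptr f p i → f i + f i + (p + p) ≡ i + i
double-split {f} {p} {i} (ptr h) = trans (lemma p (f i)) (cong (λ z → z + z) h)
  where
  lemma : ∀ p z → z + z + (p + p) ≡ p + z + (p + z)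
  lemma = solve-∀

-- An odd index minus odd values is even: the look-ups at 2n + 3 fall on 2q + 2 and 2p + 2, and the
-- sign is -1.
Odd-suc : ∀ n → (∀ i → i ≤ n → Even i) → Odd n → Odd (suc n)
Odd-suc n even odd with ptrX n | ptrY n
... | p , hp | q , hq = trans (cong (Qt ∘ suc) (cong suc (+-suc n n)))
  (trans (Qt-rec {n + n} {w = suc (q + q)} {w′ = suc (p + p)} (even n ≤-refl) odd
                 (index hq) (index hp)
                 (s≤s (s≤s (+-mono-≤ (ptr-≤ hq) (ptr-≤ hq))))
                 (s≤s (s≤s (+-mono-≤ (ptr-≤ hp) (ptr-≤ hp)))))
  (trans (cong₂ ℤ._+_ (cong₂ ℤ._+_ (even q (ptr-≤ hq)) (even p (ptr-≤ hp)))
                      (cong (λ z → ℤ.- (ℤ.- (ℤ.- z))) (sgn-even n)))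
  (cong +_ (trans (lemma (Y q) (Y p)) (cong (λ z → suc (z + z)) (sym (X-rec hp hq)))))))
  where
  lemma′ : ∀ a b → suc a + (2 + b) ≡ 3 + (a + b)
  lemma′ = solve-∀
  lemma : ∀ a b → a + a + suc (b + b) ≡ suc (a + b + (a + b))
  lemma = solve-∀
  index : ∀ {f p} → Ptr f p n → suc (f n + f n) + (2 + (p + p)) ≡ 3 + (n + n)
  index {f} {p} h = trans (lemma′ (f n + f n) (p + p)) (cong (λ z → 3 + z) (double-split h))

-- The look-ups at 2n + 4 fall on the odd indices 2p + 1 and 2q + 3; the sign +1 accounts for the
-- `suc` in `Y-rec`.
Even-suc : ∀ n → (∀ i → i ≤ suc n → Odd i) → Even n → Even (suc n)
Even-suc n odd even with ptrX (suc n) | ptrY n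
... | p , hp | q , hq = trans (cong (λ z → Qt (3 + z)) (+-suc n n))
  (trans (Qt-rec {suc (n + n)} {w = p + p} {w′ = suc q + suc q}
            (trans (cong (λ z → Qt (2 + z)) (sym (+-suc n n))) (odd (suc n) ≤-refl)) even
            (trans (+-suc (suc (X (suc n) + X (suc n))) (p + p))
                   (cong (λ z → 2 + z) (trans (double-split hp) (cong suc (+-suc n n)))))
            (index hq) (s≤s (≤-trans (+-mono-≤ (ptr-≤ hp) (ptr-≤ hp)) (≤-reflexive (cong suc (+-suc n n)))))
            (s≤s (s≤s (≤-trans (+-mono-≤ (ptr-≤ hq) (s≤s (ptr-≤ hq))) (≤-reflexive (+-suc n n))))))
  (trans (cong₂ ℤ._+_ (cong₂ ℤ._+_ (odd p (ptr-≤ hp)) (odd (suc q) (s≤s (ptr-≤ hq))))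
                      (trans (ℤ.neg-involutive _) (trans (ℤ.neg-involutive _) (sgn-even n))))
  (cong +_ (trans (lemma (X p) (X (suc q))) (cong (λ z → suc (z + z)) (sym (Y-rec hp hq)))))))
  where
  lemma : ∀ a b → suc (a + a) + suc (b + b) + 1 ≡ suc (suc (a + b) + suc (a + b))
  lemma = solve-∀
  lemma′ : ∀ a q → suc a + suc (suc q + suc q) ≡ 4 + (a + (q + q))
  lemma′ = solve-∀
  index : ∀ {q} → Ptr Y q n → suc (Y n + Y n) + suc (suc q + suc q) ≡ 4 + (n + n)
  index {q} h = trans (lemma′ (Y n + Y n) q) (cong (λ z → 4 + z) (double-split h))

Odd-Even : ∀ n → (∀ i → i ≤ n → Odd i) × (∀ i → i ≤ n → Even i)
Odd-Even zero =
  (λ { .zero z≤n → cong (λ z → + suc (z + z)) (sym (proj₁ X-values)) }) ,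
  (λ { .zero z≤n → cong (λ z → + suc (z + z)) (sym (proj₁ Y-values)) })
Odd-Even (suc n) with Odd-Even n
... | odd , even = odd′ , ≤-extend even (Even-suc n odd′ (even n ≤-refl))
  where
  -- `X` at n + 1 comes first, since `Y` at n + 1 depends on it.
  odd′ : ∀ i → i ≤ suc n → Odd i
  odd′ = ≤-extend odd (Odd-suc n even (odd n ≤-refl))

-- Passage to `A` and `B`

half : ∀ {z} x → z ≡ + suc (x + x) → (z ℤ.+ + 1) ℤD./ (+ 2) ≡ + suc x
half x refl = trans (ℤ.*-identityˡ _) (cong +_ (trans (cong (ℕD._/ 2) (lemma x)) (m*n/n≡m (suc x) 2)))
  where
  lemma : ∀ x → suc (x + x) + 1 ≡ suc x * 2
  lemma = solve-∀

A-suc : ∀ i → A (suc i) ≡ + suc (X i)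
A-suc i = half (X i) (trans (cong Qt (lemma i)) (proj₁ (Odd-Even i) i ≤-refl))
  where
  lemma : ∀ i → i + (suc i + 0) ≡ suc (i + i)
  lemma = solve-∀

B-suc : ∀ i → B (suc i) ≡ + suc (Y i)
B-suc i = half (Y i) (trans (cong Qt (lemma i)) (proj₂ (Odd-Even i) i ≤-refl))
  where
  lemma : ∀ i → 2 * suc i ≡ 2 + (i + i)
  lemma = solve-∀

difference : ∀ {f : ℕ → ℕ} {z w i} → Unit f i → z ≡ + suc (f (suc i)) → w ≡ + suc (f i) →
             z ℤ.- w ≡ + 0 ⊎ z ℤ.- w ≡ + 1
difference {f} {i = i} (inj₁ e) refl refl rewrite e = inj₁ (ℤ.+-inverseʳ (+ suc (f i)))
difference {f} {i = i} (inj₂ e) refl refl rewrite e =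
  inj₂ (trans (ℤ.+-assoc (+ 1) (+ suc (f i)) (ℤ.- (+ suc (f i))))
   (cong (λ z → + 1 ℤ.+ z) (ℤ.+-inverseʳ (+ suc (f i)))))

-- Closed forms of `a`, `u` and `v`

a-value : ∀ r → a r ≡ suc (first r + suc r)
a-value r = trans (cong (ℕD._/ 3) (power r)) (m*n/n≡m (suc (first r + suc r)) 3)
  where
  lemma : ∀ x → 2 * (4 * x) + 1 + 3 ≡ 4 * (2 * x + 1)
  lemma = solve-∀
  lemma′ : ∀ s r → 4 * (suc (s + suc r) * 3) ≡
           suc (suc (suc (s + s + r)) + suc (s + s + r) + suc r + suc (suc r)) * 3 + 3
  lemma′ = solve-∀
  -- With c = 2·4^(r+1) + 1 the next term is 4c - 3; adding 3 on both sides avoids the subtraction.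
  power : ∀ r → 2 * 4 ^ suc r + 1 ≡ suc (first r + suc r) * 3
  power zero    = refl
  power (suc r) = +-cancelʳ-≡ 3 _ _ (trans (lemma (4 ^ suc r)) (trans (cong (4 *_) (power r)) (lemma′ (first r) r)))

u-value : ∀ r → u r ≡ suc (top (first r) r)
u-value r = trans (cong (λ z → 2 * z ∸ r ∸ 2) (a-value r))
  (trans (cong (λ z → z ∸ r ∸ 2) (lemma (first r) r)) (cong (_∸ 2) (m+n∸n≡m _ r)))
  where
  -- The summands 2 and `r` are split off so that both truncated subtractions are exact.
  lemma : ∀ s r → 2 * suc (s + suc r) ≡ 2 + suc (suc (s + s + r)) + r
  lemma = solve-∀

v-value : ∀ r → v r ≡ 2 + next (first r) r
v-value r = trans (cong (λ z → 4 * z ∸ r ∸ 2) (a-value r))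
  (trans (cong (λ z → z ∸ r ∸ 2) (lemma (first r) r)) (cong (_∸ 2) (m+n∸n≡m _ r)))
  where
  lemma : ∀ s r → 4 * suc (s + suc r) ≡ 4 + (suc (suc (s + s + r)) + suc (s + s + r) + suc r) + r
  lemma = solve-∀

double-a : ∀ r → suc (top (first r) r) + suc r ≡ first r + suc r + suc (first r + suc r + 0)
double-a r = lemma (first r) r
  where
  lemma : ∀ s r → suc (suc (s + s + r)) + suc r ≡ s + suc r + suc (s + suc r + 0)
  lemma = solve-∀

A-value : ∀ {m i n z} → m ≡ suc i → suc (X i) ≡ n → z ≡ + n → A m ≡ z
A-value {i = i} refl refl refl = A-suc i

B-value : ∀ {m i n z} → m ≡ suc i → suc (Y i) ≡ n → z ≡ + n → B m ≡ z
B-value {i = i} refl refl refl = B-suc i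

theorem4p8 : ((m : ℕ) → m ≥ 1 → (ΔA m ≡ + 0 ⊎ ΔA m ≡ + 1) × (ΔB m ≡ + 0 ⊎ ΔB m ≡ + 1))
    × ((r : ℕ) →
    (A (u r) ≡ + a r) × (B (u r) ≡ + a r)
    × (A (v r) ≡ + (2 Data.Nat.* a r)) × (B (v r) ≡ + (2 Data.Nat.* a r))
    × (B (suc (u r)) ≡ + a r ℤ.+ + 1)
    × (A (v r ∸ 1) ≡ + (2 Data.Nat.* a r) ℤ.- + 1)
    × (B (v r ∸ 1) ≡ + (2 Data.Nat.* a r))
    × (A (u (suc r) ∸ 1) ≡ + a (suc r))
    × (B (u (suc r) ∸ 1) ≡ + a (suc r) ℤ.- + 1))
theorem4p8 = differences , λ r →
  let module I  = PhaseI-Start (phaseI-start r)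
      module II = PhaseII-Start (phaseII-start r)
      module E  = PhaseII (first r) r (phaseII-start r)
      2a    = cong (λ z → + (2 * z)) (a-value r)
      v⁻    = cong (_∸ 1) (v-value r)
      u⁻    = cong (_∸ 1) (u-value (suc r))
      1+t+k = sym (+-suc (next (first r) r) (suc r))
  in A-value (u-value r) (cong suc I.X-top) (cong +_ (a-value r))
   , B-value (u-value r) (cong suc I.Y-top) (cong +_ (a-value r))
   , A-value (v-value r) (cong suc (trans II.X-t⁺ (double-a r))) 2a
   , B-value (v-value r) (cong suc (trans II.Y-t⁺ (double-a r))) 2a
   , B-value (cong suc (u-value r)) (cong suc (trans I.Y-top⁺ (+-comm 1 _)))
       (cong (λ z → + (z + 1)) (a-value r))
   , A-value v⁻ (trans (cong suc II.X-t) (double-a r))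
       (cong (λ z → + (2 * z) ℤ.- + 1) (a-value r))
   , B-value v⁻ (cong suc (trans II.Y-t (double-a r))) 2a
   -- u_{r+1} - 1 is N + 1, hence index `N`, where the path of phase II ends.
   , A-value u⁻ (cong suc (trans E.X-N 1+t+k)) (cong +_ (a-value (suc r)))
   , B-value u⁻ (trans (cong suc E.Y-N) 1+t+k)
       (cong (λ z → + z ℤ.- + 1) (a-value (suc r)))
  where
  differences : (m : ℕ) → m ≥ 1 → (ΔA m ≡ + 0 ⊎ ΔA m ≡ + 1) × (ΔB m ≡ + 0 ⊎ ΔB m ≡ + 1)
  differences (suc i) _ =
    difference {X} (unitX i) (A-suc (suc i)) (A-suc i) ,
    difference {Y} (unitY i) (B-suc (suc i)) (B-suc i)
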